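{- Let $p$ be an odd rational prime, $\zeta$ a primitive $p$-th root of unity, $K=\mathbb{Q}(\zeta)$ with ring of algebraic integers $O_{K}=\mathbb{Z}[\zeta]$, and let $\sigma,\tau$ be any two different non-zero ring endomorphisms of $O_{K}$. Let $D:O_{K}\to O_{K}$ be a $\mathbb{Z}$-linear map with $D(1)=0$. Then $D$ is a $(\sigma,\tau)$-derivation if and only if for all $k\in\{1,2,\dots,p-2\}$ $$D(\zeta^{k})=\left(\sum_{(i,j)\in S_{k-1}}\sigma(\zeta^{i})\tau(\zeta^{j})\right)D(\zeta).$$
   Context: A $(\sigma,\tau)$-derivation of $O_{K}$ is a $\mathbb{Z}$-linear map $D:O_{K}\to O_{K}$ with $D(xy)=D(x)\tau(y)+\sigma(x)D(y)$ for all $x,y\in O_{K}$. For a non-negative integer $k$, $S_{k}$ is the set of all ordered pairs $(i,j)$ of non-negative integers with $i+j=k$. -}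

module Defs where

open import Level using (Level; _⊔_)
open import Algebra.Bundles using (CommutativeRing; CommutativeMonoid; Semiring)
open import Algebra.Bundles.Raw using (RawRing)
open import Algebra.Apartness.Bundles using (HeytingField; HeytingCommutativeRing)
open import Algebra.Morphism.Structures using (module RingWithoutOneMorphisms)
open import Algebra.Module.Bundles.Raw using (RawLeftModule)
open import Algebra.Module.Morphism.Structures using (module LeftModuleMorphisms)
open import Data.Fin.Base using (Fin; toℕ; fromℕ<) renaming (zero to fzero; suc to fsuc)
open import Data.Fin.Properties using (toℕ<n; toℕ-fromℕ<)
open import Data.Integer.Base as ℤ using (ℤ; -[1+_]; _⊖_)
import Data.Integer.Properties as ℤₚ
open import Data.List.Base using (List; []; _∷_; _++_; map; foldr; applyUpTo; tabulate; cartesianProductWith)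
open import Data.List.Membership.Propositional using (_∈_)
open import Data.List.Membership.Propositional.Properties using (∈-applyUpTo⁺; ∈-applyUpTo⁻; ∈-tabulate⁻)
open import Data.List.Relation.Unary.All using (All; []; _∷_)
import Data.List.Relation.Unary.All as All
open import Data.List.Relation.Unary.All.Properties using (cartesianProductWith⁺)
open import Data.List.Relation.Unary.Unique.Propositional using (Unique)
open import Data.List.Relation.Unary.Unique.Propositional.Properties using (applyUpTo⁺₁)
open import Data.Nat.Base as ℕ using (ℕ; zero; suc; NonZero; s≤s; z≤n)
import Data.Nat.Properties as ℕₚ
open import Data.Product.Base using (Σ; ∃; ∃-syntax; _,_; proj₁; proj₂) renaming (_×_ to _∧_)
open import Data.Sum.Base using (inj₁; inj₂)
open import Function.Bundles using (_⇔_; mk⇔)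
import Relation.Binary.PropositionalEquality as ≡
open ≡ using (_≡_)
open import Relation.Nullary.Negation using (¬_)

private
  variable
    c ℓ ℓ₁ ℓ₂ : Level

S : ℕ → List (ℕ ∧ ℕ)
S k = applyUpTo (λ i → i , k ℕ.∸ i) (suc k)

∈S⇔ : ∀ {k i j} → (i , j) ∈ S k ⇔ i ℕ.+ j ≡ k
∈S⇔ {k} {i} {j} = mk⇔ to from
  where
  to : (i , j) ∈ S k → i ℕ.+ j ≡ k
  to p with ∈-applyUpTo⁻ (λ i → i , k ℕ.∸ i) p
  ... | _ , s≤s i≤k , ≡.refl = ℕₚ.m+[n∸m]≡n i≤k
  from : i ℕ.+ j ≡ k → (i , j) ∈ S k
  from ≡.refl = ≡.subst (λ l → (i , l) ∈ S (i ℕ.+ j)) (ℕₚ.m+n∸m≡n i j)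
    (∈-applyUpTo⁺ (λ l → l , (i ℕ.+ j) ℕ.∸ l) (s≤s (ℕₚ.m≤m+n i j)))

S-unique : ∀ k → Unique (S k)
S-unique k = applyUpTo⁺₁ (λ i → i , k ℕ.∸ i) (suc k) (λ i<j _ eq → ℕₚ.<⇒≢ i<j (≡.cong proj₁ eq))

module IntegerMultiples (R : RawRing c ℓ) where
  open RawRing R
  open import Algebra.Definitions.RawMonoid +-rawMonoid using (_×_)

  infixr 8 _·_
  _·_ : ℤ → Carrier → Carrier
  (ℤ.+ n)  · x = n × x
  -[1+ n ] · x = - (suc n × x)

  ℤ-module : RawLeftModule ℤ c ℓ
  ℤ-module = record
    { Carrierᴹ = Carrier
    ; _≈ᴹ_     = _≈_
    ; _+ᴹ_     = _+_
    ; _*ₗ_     = _·_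
    ; 0ᴹ       = 0#
    ; -ᴹ_      = -_
    }

module AlgebraicIntegers (R : CommutativeRing c ℓ) where
  open CommutativeRing R
  open IntegerMultiples rawRing public
  open import Algebra.Properties.Semiring.Exp semiring public using (_^_)
  open import Algebra.Properties.Semiring.Sum semiring public using (sum-syntax)
  open import Algebra.Properties.Semiring.Sum semiring using (*-distribˡ-sum; sum-cong-≋)
  open import Algebra.Properties.Semiring.Exp semiring using (^-congˡ; ^-homo-*)
  open import Algebra.Properties.Semiring.Mult semiring
    using (_×_; ×-congʳ; ×-homo-+; ×1-homo-*; ×-assoc-*)
  open import Algebra.Properties.Ring ring using (-0#≈0#; -‿distribˡ-*; -‿distribʳ-*; -‿involutive; -‿+-comm; xyx⁻¹≈y)
  open import Algebra.Properties.CommutativeSemigroup (CommutativeMonoid.commutativeSemigroup +-commutativeMonoid) using (interchange)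
  open import Algebra.Solver.Ring.NaturalCoefficients.Default commutativeSemiring using (solve; _:=_; _:+_; _:*_)
  open import Relation.Binary.Reasoning.Setoid setoid

  IsAlgebraicInteger : Carrier → Set ℓ
  IsAlgebraicInteger x =
    ∃[ n ] Σ (Fin n → ℤ) λ a → x ^ n + ∑[ i < n ] (a i · x ^ toℕ i) ≈ 0#

  IsInteger : Carrier → Set ℓ
  IsInteger x = ∃[ n ] x ≈ n · 1#

  ⊖-· : ∀ m n → (m ⊖ n) · 1# ≈ m × 1# - n × 1#
  ⊖-· m       zero    = trans (sym (+-identityʳ _)) (+-congˡ (sym -0#≈0#))
  ⊖-· zero    (suc n) = sym (+-identityˡ _)
  ⊖-· (suc m) (suc n) = begin
    (suc m ⊖ suc n) · 1#             ≡⟨ ≡.cong (_· 1#) (ℤₚ.[1+m]⊖[1+n]≡m⊖n m n) ⟩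
    (m ⊖ n) · 1#                     ≈⟨ ⊖-· m n ⟩
    m × 1# - n × 1#                  ≈⟨ lem 1# (m × 1#) (n × 1#) ⟩
    (1# + m × 1#) - (1# + n × 1#)    ∎
    where
    lem : ∀ u a b → a - b ≈ (u + a) - (u + b)
    lem u a b = begin
      a - b                          ≈⟨ +-identityˡ _ ⟨
      0# + (a - b)                   ≈⟨ +-congʳ (-‿inverseʳ u) ⟨
      (u - u) + (a - b)              ≈⟨ interchange u (- u) a (- b) ⟩
      (u + a) + (- u + - b)          ≈⟨ +-congˡ (-‿+-comm u b) ⟩
      (u + a) - (u + b)              ∎

  fromDifference : ∀ {x} m n → x ≈ m × 1# - n × 1# → IsInteger x
  fromDifference m n eq = m ⊖ n , trans eq (sym (⊖-· m n))

  toDifference : ∀ {x} → IsInteger x → ∃[ m ] ∃[ n ] x ≈ m × 1# - n × 1#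
  toDifference (ℤ.+ m    , eq) = m , 0 , trans eq (trans (sym (+-identityʳ _)) (+-congˡ (sym -0#≈0#)))
  toDifference (-[1+ n ] , eq) = 0 , suc n , trans eq (sym (+-identityˡ _))

  isInteger-0 : ∀ {x} → x ≈ 0# → IsInteger x
  isInteger-0 eq = ℤ.+ 0 , eq

  isInteger-1 : IsInteger 1#
  isInteger-1 = ℤ.+ 1 , sym (+-identityʳ 1#)

  isInteger-+ : ∀ {x y} → IsInteger x → IsInteger y → IsInteger (x + y)
  isInteger-+ X Y with toDifference X | toDifference Y
  ... | m , n , e | m′ , n′ , e′ = fromDifference (m ℕ.+ m′) (n ℕ.+ n′) (begin
    _                                                 ≈⟨ +-cong e e′ ⟩
    (m × 1# - n × 1#) + (m′ × 1# - n′ × 1#)           ≈⟨ lem (m × 1#) (n × 1#) (m′ × 1#) (n′ × 1#) ⟩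
    (m × 1# + m′ × 1#) - (n × 1# + n′ × 1#)           ≈⟨ +-cong (×-homo-+ 1# m m′) (-‿cong (×-homo-+ 1# n n′)) ⟨
    (m ℕ.+ m′) × 1# - (n ℕ.+ n′) × 1#                 ∎)
    where
    lem : ∀ a b a′ b′ → (a - b) + (a′ - b′) ≈ (a + a′) - (b + b′)
    lem a b a′ b′ = trans (interchange a (- b) a′ (- b′)) (+-congˡ (-‿+-comm b b′))

  isInteger-neg : ∀ {x} → IsInteger x → IsInteger (- x)
  isInteger-neg X with toDifference X
  ... | m , n , e = fromDifference n m (trans (-‿cong e) (lem (m × 1#) (n × 1#)))
    where
    lem : ∀ a b → - (a - b) ≈ b - a
    lem a b = trans (sym (-‿+-comm a (- b))) (trans (+-congˡ (-‿involutive b)) (+-comm (- a) b))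

  isInteger-* : ∀ {x y} → IsInteger x → IsInteger y → IsInteger (x * y)
  isInteger-* X Y with toDifference X | toDifference Y
  ... | m , n , e | m′ , n′ , e′ = fromDifference (m ℕ.* m′ ℕ.+ n ℕ.* n′) (m ℕ.* n′ ℕ.+ n ℕ.* m′) (begin
    _                                                 ≈⟨ *-cong e e′ ⟩
    (m × 1# - n × 1#) * (m′ × 1# - n′ × 1#)           ≈⟨ lem (m × 1#) (n × 1#) (m′ × 1#) (n′ × 1#) ⟩
    (m × 1# * (m′ × 1#) + n × 1# * (n′ × 1#)) - (m × 1# * (n′ × 1#) + n × 1# * (m′ × 1#))
      ≈⟨ +-cong (prod m m′ n n′) (-‿cong (prod m n′ n m′)) ⟨
    (m ℕ.* m′ ℕ.+ n ℕ.* n′) × 1# - (m ℕ.* n′ ℕ.+ n ℕ.* m′) × 1# ∎)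
    where
    lem : ∀ a b a′ b′ → (a - b) * (a′ - b′) ≈ (a * a′ + b * b′) - (a * b′ + b * a′)
    lem a b a′ b′ = begin
      (a - b) * (a′ - b′)
        ≈⟨ solve 4 (λ a b a′ b′ → (a :+ b) :* (a′ :+ b′) := (a :* a′ :+ b :* b′) :+ (a :* b′ :+ b :* a′)) refl a (- b) a′ (- b′) ⟩
      (a * a′ + - b * - b′) + (a * - b′ + - b * a′)
        ≈⟨ +-cong (+-congˡ (trans (sym (-‿distribˡ-* b (- b′))) (trans (-‿cong (sym (-‿distribʳ-* b b′))) (-‿involutive _))))
                  (trans (+-cong (sym (-‿distribʳ-* a b′)) (sym (-‿distribˡ-* b a′))) (-‿+-comm _ _)) ⟩
      (a * a′ + b * b′) - (a * b′ + b * a′) ∎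
    prod : ∀ i j k l → (i ℕ.* j ℕ.+ k ℕ.* l) × 1# ≈ i × 1# * (j × 1#) + k × 1# * (l × 1#)
    prod i j k l = trans (×-homo-+ 1# (i ℕ.* j) (k ℕ.* l)) (+-cong (×1-homo-* i j) (×1-homo-* k l))

  ·-assoc-* : ∀ n x y → (n · x) * y ≈ n · (x * y)
  ·-assoc-* (ℤ.+ n)  x y = ×-assoc-* n x y
  ·-assoc-* -[1+ n ] x y = trans (sym (-‿distribˡ-* (suc n × x) y)) (-‿cong (×-assoc-* (suc n) x y))

  ·-congˡ : ∀ n {x y} → x ≈ y → n · x ≈ n · y
  ·-congˡ (ℤ.+ n)  eq = ×-congʳ n eq
  ·-congˡ -[1+ n ] eq = -‿cong (×-congʳ (suc n) eq)

  ·1-* : ∀ n x → (n · 1#) * x ≈ n · x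
  ·1-* n x = trans (·-assoc-* n 1# x) (·-congˡ n (*-identityˡ x))

  -- Combination P xs x: x is a linear combination of xs with coefficients in P.
  data Combination {p} (P : Carrier → Set p) : List Carrier → Carrier → Set (c ⊔ ℓ ⊔ p) where
    nil  : ∀ {x} → x ≈ 0# → Combination P [] x
    cons : ∀ {v vs x} a b → P a → Combination P vs b → x ≈ a * v + b → Combination P (v ∷ vs) x

  module _ {p : Level} {P : Carrier → Set p} where

    comb-resp : ∀ {vs x y} → x ≈ y → Combination P vs x → Combination P vs y
    comb-resp eq (nil e)            = nil (trans (sym eq) e)
    comb-resp eq (cons a b pa cb e) = cons a b pa cb (trans (sym eq) e)

    comb-+ : (∀ {a b} → P a → P b → P (a + b)) →
             ∀ {vs x y} → Combination P vs x → Combination P vs y → Combination P vs (x + y)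
    comb-+ p+ (nil e) (nil e′) = nil (trans (+-cong e e′) (+-identityˡ 0#))
    comb-+ p+ {v ∷ _} (cons a b pa cb e) (cons a′ b′ pa′ cb′ e′) =
      cons (a + a′) (b + b′) (p+ pa pa′) (comb-+ p+ cb cb′) (trans (+-cong e e′) (lem a b a′ b′ v))
      where
      lem : ∀ a b a′ b′ v → (a * v + b) + (a′ * v + b′) ≈ (a + a′) * v + (b + b′)
      lem = solve 5 (λ a b a′ b′ v → (a :* v :+ b) :+ (a′ :* v :+ b′) := (a :+ a′) :* v :+ (b :+ b′)) refl

    comb-* : ∀ {q} {Q : Carrier → Set q} r → (∀ {a} → P a → Q (r * a)) →
             ∀ {vs x} → Combination P vs x → Combination Q vs (r * x)
    comb-* r pq (nil e) = nil (trans (*-congˡ e) (zeroʳ r))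
    comb-* r pq {v ∷ _} (cons a b pa cb e) =
      cons (r * a) (r * b) (pq pa) (comb-* r pq cb) (trans (*-congˡ e) (lem r a b v))
      where
      lem : ∀ r a b v → r * (a * v + b) ≈ (r * a) * v + r * b
      lem = solve 4 (λ r a b v → r :* (a :* v :+ b) := (r :* a) :* v :+ r :* b) refl

    comb-0 : P 0# → ∀ {x} vs → x ≈ 0# → Combination P vs x
    comb-0 p0 []       e = nil e
    comb-0 p0 (v ∷ vs) e =
      cons 0# 0# p0 (comb-0 p0 vs refl) (trans e (sym (trans (+-identityʳ _) (zeroˡ v))))

    comb-++ : ∀ {vs ws x y} → Combination P vs x → Combination P ws y → Combination P (vs ++ ws) (x + y)
    comb-++ {y = y} (nil e) cy = comb-resp (sym (trans (+-congʳ e) (+-identityˡ y))) cy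
    comb-++ {y = y} (cons a b pa cb e) cy =
      cons a (b + y) pa (comb-++ cb cy) (trans (+-congʳ e) (+-assoc _ b y))

    comb-map : ∀ v {ws y} → Combination P ws y → Combination P (map (v *_) ws) (v * y)
    comb-map v (nil e) = nil (trans (*-congˡ e) (zeroʳ v))
    comb-map v {w ∷ _} (cons a b pa cb e) =
      cons a (v * b) pa (comb-map v cb) (trans (*-congˡ e) (lem v a b w))
      where
      lem : ∀ v a b w → v * (a * w + b) ≈ a * (v * w) + v * b
      lem = solve 4 (λ v a b w → v :* (a :* w :+ b) := a :* (v :* w) :+ v :* b) refl

    comb-product : (∀ {a b} → P a → P b → P (a * b)) → ∀ {vs ws x y} →
                   Combination P vs x → Combination P ws y → Combination P (cartesianProductWith _*_ vs ws) (x * y)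
    comb-product p* {y = y} (nil e) cy = nil (trans (*-congʳ e) (zeroˡ y))
    comb-product p* {v ∷ _} {y = y} (cons a b pa cb e) cy =
      comb-resp (trans (lem v a y b) (*-congʳ (sym e)))
        (comb-++ (comb-map v (comb-* a (p* pa) cy)) (comb-product p* cb cy))
      where
      lem : ∀ v a y b → v * (a * y) + b * y ≈ (a * v + b) * y
      lem = solve 4 (λ v a y b → v :* (a :* y) :+ b :* y := (a :* v :+ b) :* y) refl

  Span : List Carrier → Carrier → Set (c ⊔ ℓ)
  Span = Combination IsInteger

  span-* : ∀ {vs ws} x → All (λ w → Span vs (x * w)) ws → ∀ {y} → Span ws y → Span vs (x * y)
  span-* {vs} x []       (nil e) = comb-0 (isInteger-0 refl) vs (trans (*-congˡ e) (zeroʳ x))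
  span-* {ws = w ∷ _} x (s ∷ ss) (cons a b pa cb e) =
    comb-resp (trans (lem x a b w) (*-congˡ (sym e)))
      (comb-+ isInteger-+ (comb-* a (isInteger-* pa) s) (span-* x ss cb))
    where
    lem : ∀ x a b w → a * (x * w) + x * b ≈ x * (a * w + b)
    lem = solve 4 (λ x a b w → a :* (x :* w) :+ x :* b := x :* (a :* w :+ b)) refl

  module Polynomials (z : Carrier) where

    -- Poly d x: x is the value at z of an integer polynomial of degree < d.
    data Poly : ℕ → Carrier → Set (c ⊔ ℓ) where
      nil  : ∀ {x} → x ≈ 0# → Poly 0 x
      cons : ∀ {d x} a b → IsInteger a → Poly d b → x ≈ a + z * b → Poly (suc d) x

    -- Monic d x: x is the value at z of a monic integer polynomial of degree d.
    Monic : ℕ → Carrier → Set (c ⊔ ℓ)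
    Monic d x = ∃[ b ] Poly d b ∧ x ≈ z ^ d + b

    poly-resp : ∀ {d x y} → x ≈ y → Poly d x → Poly d y
    poly-resp eq (nil e)            = nil (trans (sym eq) e)
    poly-resp eq (cons a b ia pb e) = cons a b ia pb (trans (sym eq) e)

    poly-0 : ∀ d {x} → x ≈ 0# → Poly d x
    poly-0 zero    e = nil e
    poly-0 (suc d) e = cons 0# 0# (isInteger-0 refl) (poly-0 d refl)
                         (trans e (sym (trans (+-identityˡ _) (zeroʳ z))))

    poly-≤ : ∀ {d d′ x} → d ℕ.≤ d′ → Poly d x → Poly d′ x
    poly-≤ {d′ = d′} z≤n (nil e)            = poly-0 d′ e
    poly-≤ (s≤s le)      (cons a b ia pb e) = cons a b ia (poly-≤ le pb) e

    poly-+ : ∀ {d x y} → Poly d x → Poly d y → Poly d (x + y)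
    poly-+ (nil e) (nil e′) = nil (trans (+-cong e e′) (+-identityˡ 0#))
    poly-+ (cons a b ia pb e) (cons a′ b′ ia′ pb′ e′) =
      cons (a + a′) (b + b′) (isInteger-+ ia ia′) (poly-+ pb pb′) (trans (+-cong e e′) (lem a b a′ b′ z))
      where
      lem : ∀ a b a′ b′ z → (a + z * b) + (a′ + z * b′) ≈ (a + a′) + z * (b + b′)
      lem = solve 5 (λ a b a′ b′ z → (a :+ z :* b) :+ (a′ :+ z :* b′) := (a :+ a′) :+ z :* (b :+ b′)) refl

    poly-scale : ∀ {d x n} → IsInteger n → Poly d x → Poly d (n * x)
    poly-scale {n = n} i (nil e) = nil (trans (*-congˡ e) (zeroʳ n))
    poly-scale {n = n} i (cons a b ia pb e) =
      cons (n * a) (n * b) (isInteger-* i ia) (poly-scale i pb) (trans (*-congˡ e) (lem n a b z))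
      where
      lem : ∀ n a b z → n * (a + z * b) ≈ n * a + z * (n * b)
      lem = solve 4 (λ n a b z → n :* (a :+ z :* b) := n :* a :+ z :* (n :* b)) refl

    poly-neg : ∀ {d x} → Poly d x → Poly d (- x)
    poly-neg (nil e) = nil (trans (-‿cong e) -0#≈0#)
    poly-neg (cons a b ia pb e) =
      cons (- a) (- b) (isInteger-neg ia) (poly-neg pb) (trans (-‿cong e) (lem a b z))
      where
      lem : ∀ a b z → - (a + z * b) ≈ - a + z * (- b)
      lem a b z = trans (sym (-‿+-comm a (z * b))) (+-congˡ (-‿distribʳ-* z b))

    poly-shift : ∀ {d x} → Poly d x → Poly (suc d) (z * x)
    poly-shift {x = x} px = cons 0# x (isInteger-0 refl) px (sym (+-identityˡ _))

    poly-shift^ : ∀ e {d x} → Poly d x → Poly (e ℕ.+ d) (z ^ e * x)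
    poly-shift^ zero    px = poly-resp (sym (*-identityˡ _)) px
    poly-shift^ (suc e) px = poly-resp (sym (*-assoc z (z ^ e) _)) (poly-shift (poly-shift^ e px))

    poly-* : ∀ {d e x y} → Poly d x → Poly e y → Poly (d ℕ.+ e) (x * y)
    poly-* {e = e} {y = y} (nil eq) py = poly-0 e (trans (*-congʳ eq) (zeroˡ y))
    poly-* {suc d} {e} {y = y} (cons a b ia pb eq) py =
      poly-resp (trans (lem a b z y) (*-congʳ (sym eq)))
        (poly-+ (poly-≤ (ℕₚ.m≤n+m e (suc d)) (poly-scale ia py)) (poly-shift (poly-* pb py)))
      where
      lem : ∀ a b z y → a * y + z * (b * y) ≈ (a + z * b) * y
      lem = solve 4 (λ a b z y → a :* y :+ z :* (b :* y) := (a :+ z :* b) :* y) refl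

    monic-*-poly : ∀ {d e x y} → Monic d x → Poly e y → Poly (d ℕ.+ e) (x * y)
    monic-*-poly {d} {y = y} (b , pb , eq) py =
      poly-resp (trans (sym (distribʳ y _ b)) (*-congʳ (sym eq)))
        (poly-+ (poly-shift^ d py) (poly-* pb py))

    monic-* : ∀ {d e x y} → Monic d x → Monic e y → Monic (d ℕ.+ e) (x * y)
    monic-* {d} {e} {x} mx@(b , pb , eq) (b′ , pb′ , eq′) =
      x * b′ + z ^ e * b ,
      poly-+ (monic-*-poly mx pb′) (≡.subst (λ k → Poly k (z ^ e * b)) (ℕₚ.+-comm e d) (poly-shift^ e pb)) ,
      (begin
        x * _                                       ≈⟨ *-congˡ eq′ ⟩
        x * (z ^ e + b′)                            ≈⟨ distribˡ x (z ^ e) b′ ⟩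
        x * z ^ e + x * b′                          ≈⟨ +-congʳ (*-congʳ eq) ⟩
        (z ^ d + b) * z ^ e + x * b′                ≈⟨ lem (z ^ d) b (z ^ e) (x * b′) ⟩
        z ^ d * z ^ e + (x * b′ + z ^ e * b)        ≈⟨ +-congʳ (^-homo-* z d e) ⟨
        z ^ (d ℕ.+ e) + (x * b′ + z ^ e * b)        ∎)
      where
      lem : ∀ u b w t → (u + b) * w + t ≈ u * w + (t + w * b)
      lem = solve 4 (λ u b w t → (u :+ b) :* w :+ t := u :* w :+ (t :+ w :* b)) refl

    monic-poly : ∀ {d x y} → Monic d x → Poly d y → Monic d (x - y)
    monic-poly {y = y} (b , pb , eq) py =
      b - y , poly-+ pb (poly-neg py) , trans (+-congʳ eq) (+-assoc _ b (- y))

    -- Row d vs u: one linear relation m * u ≈ Σ aᵥ * v over v ∈ vs, with m monic of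
    -- degree d and every aᵥ of degree < d.
    Row : ℕ → List Carrier → Carrier → Set (c ⊔ ℓ)
    Row d vs u = ∃[ m ] Monic d m ∧ Combination (Poly d) vs (m * u)

    reduce : ∀ {d v vs w μ} → Monic d μ → Combination (Poly d) vs (μ * v) →
             Row d (v ∷ vs) w → Row (d ℕ.+ d) vs w
    reduce {d} {v} {vs} {w} {μ} mμ cμ (m , mm , cons a b pa cb e) =
      μ * m , monic-* mμ mm ,
      comb-resp (begin
        a * (μ * v) + μ * b   ≈⟨ lem a μ v b ⟩
        μ * (a * v + b)       ≈⟨ *-congˡ e ⟨
        μ * (m * w)           ≈⟨ *-assoc μ m w ⟨
        μ * m * w             ∎)
        (comb-+ poly-+ (comb-* a (poly-* pa) cμ) (comb-* μ (monic-*-poly mμ) cb))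
      where
      lem : ∀ a μ v b → a * (μ * v) + μ * b ≈ μ * (a * v + b)
      lem = solve 4 (λ a μ v b → a :* (μ :* v) :+ μ :* b := μ :* (a :* v :+ b)) refl

    eliminate : ∀ vs {d u} → All (Row d vs) vs → Row d vs u → ∃[ e ] ∃[ m ] Monic e m ∧ m * u ≈ 0#
    eliminate [] [] (m , mm , nil e) = _ , m , mm , e
    eliminate (v ∷ vs) {d} ((m , mm , cons a b pa cb e) ∷ rows) row =
      eliminate vs (All.map (reduce mμ cμ) rows) (reduce mμ cμ row)
      where
      mμ : Monic d (m - a)
      mμ = monic-poly mm pa
      lem : ∀ m a v → (m - a) * v ≈ m * v - a * v
      lem m a v = trans (distribʳ v m (- a)) (+-congˡ (sym (-‿distribˡ-* a v)))
      lem′ : ∀ t b → b ≈ (t + b) - t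
      lem′ t b = sym (xyx⁻¹≈y t b)
      cμ : Combination (Poly d) vs ((m - a) * v)
      cμ = comb-resp (begin
        b                        ≈⟨ lem′ (a * v) b ⟩
        (a * v + b) - a * v      ≈⟨ +-congʳ e ⟨
        m * v - a * v            ≈⟨ lem m a v ⟨
        (m - a) * v              ∎) (comb-resp refl cb)

    poly-∑ : ∀ {d x} → Poly d x → Σ (Fin d → ℤ) λ a → x ≈ ∑[ i < d ] (a i · z ^ toℕ i)
    poly-∑ (nil e) = (λ ()) , e
    poly-∑ {suc d} {x} (cons a b (n , en) pb e) with poly-∑ pb
    ... | f , ef = g , (begin
      x                                              ≈⟨ e ⟩
      a + z * b                                      ≈⟨ +-cong en (*-congˡ ef) ⟩
      n · 1# + z * ∑[ i < d ] (f i · z ^ toℕ i)      ≈⟨ +-congˡ (*-distribˡ-sum z (λ i → f i · z ^ toℕ i)) ⟩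
      n · 1# + ∑[ i < d ] (z * (f i · z ^ toℕ i))    ≈⟨ +-congˡ (sum-cong-≋ (λ i → swap (f i) (z ^ toℕ i))) ⟩
      n · 1# + ∑[ i < d ] (f i · (z * z ^ toℕ i))    ∎)
      where
      g : Fin (suc d) → ℤ
      g fzero    = n
      g (fsuc i) = f i
      swap : ∀ k y → z * (k · y) ≈ k · (z * y)
      swap k y = trans (*-comm z _) (trans (·-assoc-* k y z) (·-congˡ k (*-comm y z)))

    monic-root⇒integer : ∀ {d x} → Monic d x → x ≈ 0# → IsAlgebraicInteger z
    monic-root⇒integer {d} (b , pb , eq) x≈0 with poly-∑ pb
    ... | a , ea = d , a , trans (+-congˡ (sym ea)) (trans (sym eq) x≈0)

  -- If the span of vs is stable under multiplication by z and contains 1,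
  -- then eliminating vs from the relations z * v ≈ Σ … leaves a monic equation for z.
  stable⇒integer : ∀ z vs → All (λ v → Span vs (z * v)) vs → Span vs 1# → IsAlgebraicInteger z
  stable⇒integer z vs stable one
    with eliminate vs (All.map row stable) (row (span-* z stable one))
    where
    open Polynomials z
    const : ∀ {a} → IsInteger a → Poly 1 (1# * a)
    const {a} ia = cons a 0# ia (nil refl)
      (trans (*-identityˡ a) (sym (trans (+-congˡ (zeroʳ z)) (+-identityʳ a))))
    row : ∀ {v} → Span vs (z * v) → Row 1 vs v
    row s = z , (0# , cons 0# 0# (isInteger-0 refl) (nil refl) (sym (trans (+-identityˡ _) (zeroʳ z))) ,
                 sym (trans (+-identityʳ _) (*-identityʳ z)))
              , comb-resp (*-identityˡ _) (comb-* 1# const s)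
  ... | e , m , mm , eq = Polynomials.monic-root⇒integer z mm (trans (sym (*-identityʳ m)) eq)

  span-1 : ∀ {n} (v : Fin n → Carrier) i → Span (tabulate v) (v i)
  span-1 v fzero    = cons 1# 0# isInteger-1 (comb-0 (isInteger-0 refl) _ refl)
    (sym (trans (+-identityʳ _) (*-identityˡ _)))
  span-1 v (fsuc i) = cons 0# (v (fsuc i)) (isInteger-0 refl) (span-1 (λ j → v (fsuc j)) i)
    (sym (trans (+-congʳ (zeroˡ _)) (+-identityˡ _)))

  span-∑ : ∀ {n} (a : Fin n → ℤ) (v : Fin n → Carrier) → Span (tabulate v) (∑[ i < n ] (a i · v i))
  span-∑ {zero}  a v = nil refl
  span-∑ {suc n} a v = cons (a fzero · 1#) _ (a fzero , refl)
    (span-∑ (λ i → a (fsuc i)) (λ i → v (fsuc i))) (+-congʳ (sym (·1-* (a fzero) (v fzero))))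

  powers : Carrier → ℕ → List Carrier
  powers x n = tabulate {n = n} (λ i → x ^ toℕ i)

  powers-span : ∀ {x} ((n , _) : IsAlgebraicInteger x) k → k ℕ.≤ n → Span (powers x n) (x ^ k)
  powers-span {x} (n , a , eq) k k≤n with ℕₚ.m≤n⇒m<n∨m≡n k≤n
  ... | inj₁ k<n = ≡.subst (λ j → Span (powers x n) (x ^ j)) (toℕ-fromℕ< k<n) (span-1 (λ i → x ^ toℕ i) (fromℕ< k<n))
  ... | inj₂ ≡.refl = comb-resp (begin
    (- 1#) * t                ≈⟨ lem (x ^ n) t ⟩
    x ^ n - (x ^ n + t)        ≈⟨ +-congˡ (trans (-‿cong eq) -0#≈0#) ⟩
    x ^ n + 0#                 ≈⟨ +-identityʳ _ ⟩
    x ^ n                      ∎)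
    (comb-* (- 1#) (isInteger-* (isInteger-neg isInteger-1)) (span-∑ a (λ i → x ^ toℕ i)))
    where
    t = ∑[ i < n ] (a i · x ^ toℕ i)
    lem : ∀ y t → (- 1#) * t ≈ y - (y + t)
    lem y t = begin
      (- 1#) * t              ≈⟨ trans (sym (-‿distribˡ-* 1# t)) (-‿cong (*-identityˡ t)) ⟩
      - t                     ≈⟨ +-identityˡ _ ⟨
      0# - t                  ≈⟨ +-congʳ (-‿inverseʳ y) ⟨
      (y - y) - t             ≈⟨ +-assoc y (- y) (- t) ⟩
      y + (- y - t)           ≈⟨ +-congˡ (-‿+-comm y t) ⟩
      y - (y + t)             ∎

  module _ {x y : Carrier} (X : IsAlgebraicInteger x) (Y : IsAlgebraicInteger y) where

    private
      n m : ℕ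
      n = proj₁ X
      m = proj₁ Y

    products : List Carrier
    products = cartesianProductWith _*_ (powers x n) (powers y m)

    products-span : ∀ {u v} → Span (powers x n) u → Span (powers y m) v → Span products (u * v)
    products-span = comb-product isInteger-*

    products-1 : Span products 1#
    products-1 = comb-resp (*-identityˡ 1#) (products-span (powers-span X 0 z≤n) (powers-span Y 0 z≤n))

    products-All : ∀ {p} {P : Carrier → Set p} →
                   (∀ (i : Fin n) (j : Fin m) → P (x ^ toℕ i * y ^ toℕ j)) → All P products
    products-All {P = P} f = cartesianProductWith⁺ (≡.setoid Carrier) (≡.setoid Carrier) _*_ (powers x n) (powers y m) λ p q →
      let i , u≡ = ∈-tabulate⁻ p ; j , v≡ = ∈-tabulate⁻ q in
      ≡.subst₂ (λ u v → P (u * v)) (≡.sym u≡) (≡.sym v≡) (f i j)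

    products-x : ∀ (i : Fin n) (j : Fin m) → Span products (x * (x ^ toℕ i * y ^ toℕ j))
    products-x i j = comb-resp (*-assoc x _ _)
      (products-span (powers-span X (suc (toℕ i)) (toℕ<n i)) (powers-span Y (toℕ j) (ℕₚ.<⇒≤ (toℕ<n j))))

    products-y : ∀ (i : Fin n) (j : Fin m) → Span products (y * (x ^ toℕ i * y ^ toℕ j))
    products-y i j = comb-resp (lem (x ^ toℕ i) y (y ^ toℕ j))
      (products-span (powers-span X (toℕ i) (ℕₚ.<⇒≤ (toℕ<n i))) (powers-span Y (suc (toℕ j)) (toℕ<n j)))
      where
      lem : ∀ u y v → u * (y * v) ≈ y * (u * v)
      lem = solve 3 (λ u y v → u :* (y :* v) := y :* (u :* v)) refl

    abstract
      integer-+ : IsAlgebraicInteger (x + y)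
      integer-+ = stable⇒integer (x + y) products
        (products-All λ i j → comb-resp (sym (distribʳ _ x y)) (comb-+ isInteger-+ (products-x i j) (products-y i j)))
        products-1

      integer-* : IsAlgebraicInteger (x * y)
      integer-* = stable⇒integer (x * y) products
        (products-All λ i j → comb-resp (sym (*-assoc x y _))
          (span-* x (products-All products-x) (products-y i j)))
        products-1

  abstract
    isInteger⇒integer : ∀ {x} → IsInteger x → IsAlgebraicInteger x
    isInteger⇒integer {x} ix = stable⇒integer x (1# ∷ []) (s ∷ [])
      (cons 1# 0# isInteger-1 (nil refl) (sym (trans (+-identityʳ _) (*-identityˡ 1#))))
      where
      s : Span (1# ∷ []) (x * 1#)
      s = cons x 0# ix (nil refl) (sym (+-identityʳ _))

    integer-resp : ∀ {x y} → x ≈ y → IsAlgebraicInteger x → IsAlgebraicInteger y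
    integer-resp x≈y (n , a , eq) = n , a ,
      trans (sym (+-cong (^-congˡ n x≈y) (sum-cong-≋ (λ i → ·-congˡ (a i) (^-congˡ (toℕ i) x≈y))))) eq

    integer-neg : ∀ {x} → IsAlgebraicInteger x → IsAlgebraicInteger (- x)
    integer-neg {x} X = integer-resp (trans (sym (-‿distribˡ-* 1# x)) (-‿cong (*-identityˡ x)))
      (integer-* (isInteger⇒integer (isInteger-neg isInteger-1)) X)

    rootOfUnity⇒integer : ∀ n .{{_ : NonZero n}} {x} → x ^ n ≈ 1# → IsAlgebraicInteger x
    rootOfUnity⇒integer (suc n) {x} eq = monic-root⇒integer
      (- 1# , cons (- 1#) 0# (isInteger-neg isInteger-1) (poly-0 n refl)
                (sym (trans (+-congˡ (zeroʳ x)) (+-identityʳ _))) , refl)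
      (trans (+-congʳ eq) (-‿inverseʳ 1#))
      where open Polynomials x

  𝓞 : CommutativeRing (c ⊔ ℓ) ℓ
  𝓞 = record
    { Carrier = Σ Carrier IsAlgebraicInteger
    ; _≈_     = λ x y → proj₁ x ≈ proj₁ y
    ; _+_     = λ x y → proj₁ x + proj₁ y , integer-+ (proj₂ x) (proj₂ y)
    ; _*_     = λ x y → proj₁ x * proj₁ y , integer-* (proj₂ x) (proj₂ y)
    ; -_      = λ x → - proj₁ x , integer-neg (proj₂ x)
    ; 0#      = 0# , isInteger⇒integer (isInteger-0 refl)
    ; 1#      = 1# , isInteger⇒integer isInteger-1
    ; isCommutativeRing = record
      { isRing = record
        { +-isAbelianGroup = record
          { isGroup = record
            { isMonoid = record
              { isSemigroup = record
                { isMagma = record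
                  { isEquivalence = record { refl = refl ; sym = sym ; trans = trans }
                  ; ∙-cong = +-cong
                  }
                ; assoc = λ x y z → +-assoc (proj₁ x) (proj₁ y) (proj₁ z)
                }
              ; identity = (λ x → +-identityˡ (proj₁ x)) , (λ x → +-identityʳ (proj₁ x))
              }
            ; inverse = (λ x → -‿inverseˡ (proj₁ x)) , (λ x → -‿inverseʳ (proj₁ x))
            ; ⁻¹-cong = -‿cong
            }
          ; comm = λ x y → +-comm (proj₁ x) (proj₁ y)
          }
        ; *-cong = *-cong
        ; *-assoc = λ x y z → *-assoc (proj₁ x) (proj₁ y) (proj₁ z)
        ; *-identity = (λ x → *-identityˡ (proj₁ x)) , (λ x → *-identityʳ (proj₁ x))
        ; distrib = (λ x y z → distribˡ (proj₁ x) (proj₁ y) (proj₁ z)) ,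
                    (λ x y z → distribʳ (proj₁ x) (proj₁ y) (proj₁ z))
        }
      ; *-comm = λ x y → *-comm (proj₁ x) (proj₁ y)
      }
    }

module Derivations (R : CommutativeRing c ℓ) where
  open CommutativeRing R
  open IntegerMultiples rawRing
  open import Algebra.Properties.Semiring.Exp semiring public using (_^_)

  sumOver : ∀ {a} {A : Set a} → List A → (A → Carrier) → Carrier
  sumOver xs f = foldr _+_ 0# (map f xs)

  IsℤLinear : (Carrier → Carrier) → Set (c ⊔ ℓ)
  IsℤLinear = LeftModuleMorphisms.IsLeftModuleHomomorphism ℤ-module ℤ-module

  -- Not required to preserve 1#, so that the zero map is an endomorphism.
  IsEndomorphism : (Carrier → Carrier) → Set (c ⊔ ℓ)
  IsEndomorphism = RingWithoutOneMorphisms.IsRingWithoutOneHomomorphism rawRingWithoutOne rawRingWithoutOne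
    where open RawRing rawRing using (rawRingWithoutOne)

  record IsDerivation (σ τ D : Carrier → Carrier) : Set (c ⊔ ℓ) where
    field
      isℤLinear : IsℤLinear D
      leibniz   : ∀ x y → D (x * y) ≈ D x * τ y + σ x * D y

module FieldNotions (K : HeytingField c ℓ₁ ℓ₂) where
  open HeytingField K
  commutativeRing : CommutativeRing c ℓ₁
  commutativeRing = HeytingCommutativeRing.commutativeRing heytingCommutativeRing
  open CommutativeRing commutativeRing using (semiring; _≉_)
  open import Algebra.Definitions.RawSemiring (Semiring.rawSemiring semiring) using (_×_; _^_)

  CharacteristicZero : Set ℓ₂
  CharacteristicZero = ∀ n → .{{NonZero n}} → (n × 1#) # 0#

  record IsPrimitiveRoot (n : ℕ) (ζ : Carrier) : Set ℓ₁ where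
    field
      {{n≢0}} : NonZero n
      ζ^n≈1 : ζ ^ n ≈ 1#
      ζ^k≉1 : ∀ k → 0 ℕ.< k → k ℕ.< n → ζ ^ k ≉ 1#

  -- The subfield generated by ζ.  In characteristic zero it contains ℚ, so it is ℚ(ζ).
  data ℚ⟨_⟩ (ζ : Carrier) : Carrier → Set (c ⊔ ℓ₁) where
    gen   : ℚ⟨ ζ ⟩ ζ
    one   : ℚ⟨ ζ ⟩ 1#
    plus  : ∀ {x y} → ℚ⟨ ζ ⟩ x → ℚ⟨ ζ ⟩ y → ℚ⟨ ζ ⟩ (x + y)
    neg   : ∀ {x} → ℚ⟨ ζ ⟩ x → ℚ⟨ ζ ⟩ (- x)
    times : ∀ {x y} → ℚ⟨ ζ ⟩ x → ℚ⟨ ζ ⟩ y → ℚ⟨ ζ ⟩ (x * y)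
    inv   : ∀ {x y} → ℚ⟨ ζ ⟩ x → x * y ≈ 1# → ℚ⟨ ζ ⟩ y
    resp  : ∀ {x y} → x ≈ y → ℚ⟨ ζ ⟩ x → ℚ⟨ ζ ⟩ y

  𝓞K : CommutativeRing (c ⊔ ℓ₁) ℓ₁
  𝓞K = AlgebraicIntegers.𝓞 commutativeRing

  root : ∀ {n ζ} → IsPrimitiveRoot n ζ → CommutativeRing.Carrier 𝓞K
  root {n} {ζ} ζ-prim = ζ , AlgebraicIntegers.rootOfUnity⇒integer commutativeRing n (IsPrimitiveRoot.ζ^n≈1 ζ-prim)
    where open IsPrimitiveRoot ζ-prim

{-# OPTIONS --safe #-}
-- It is not necessary to know that O_K = ℤ[ζ]: every x in K has a positive multiple in
-- ℤ[ζ], and O_K is torsion-free, so two additive maps on O_K that agree on the powers of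
-- ζ are equal.  The Leibniz rule is additive in both arguments, hence need only be checked
-- on powers of ζ.  There, with s = σ(ζ), t = τ(ζ) and h(k) the sum over S(k-1), it reduces
-- to h(a+b) = h(a) t^b + s^a h(b) once D(ζ^k) = h(k) D(ζ) is known for all k.  The case
-- k ≤ p-2 is the hypothesis, and both sides have vanishing sums over any p consecutive
-- exponents: for h because (s - t) h(k) = s^k - t^k, and s ≠ t as σ ≠ τ.
module Submission where

open import Defs
open import Algebra.Bundles using (CommutativeRing)
open import Algebra.Apartness.Bundles using (HeytingField)
open import Algebra.Morphism.Structures using (module MagmaMorphisms; module RingWithoutOneMorphisms)
open import Algebra.Module.Morphism.Structures using (module LeftModuleMorphisms)
open import Data.Empty using (⊥-elim)
open import Data.Fin.Base using (Fin; toℕ) renaming (zero to fzero; suc to fsuc)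
import Data.Integer.Base as ℤ
open import Data.List.Base using (applyUpTo)
open import Data.Nat.Base as ℕ using (ℕ; zero; suc; _∸_; _≤_; _<_; z≤n; s≤s)
open import Data.Nat.Divisibility using (_∤_)
open import Data.Nat.Primality using (Prime; ¬prime[0]; ¬prime[1])
import Data.Nat.Properties as ℕₚ
open import Data.Product.Base using (Σ-syntax; ∃-syntax; _,_; proj₁) renaming (_×_ to _∧_)
open import Data.Sum.Base using (inj₁; inj₂)
open import Function.Base using (_∘_)
open import Function.Bundles using (_⇔_; mk⇔)
open import Level using (_⊔_)
import Relation.Binary.PropositionalEquality as ≡
open ≡ using (_≡_)
open import Relation.Nullary.Negation using (¬_)

-- Additive maps and the subring generated by one element.

module PowerSpan {c ℓ} (R : CommutativeRing c ℓ) where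
  open CommutativeRing R
  open IntegerMultiples rawRing
  open import Algebra.Properties.Semiring.Exp semiring using (_^_; ^-homo-*)
  open import Algebra.Properties.Semiring.Sum semiring using (sum-syntax)
  open import Algebra.Properties.Semiring.Mult semiring using (_×_; ×-congʳ; ×-comm-*)
  open import Algebra.Properties.CommutativeMonoid.Mult +-commutativeMonoid using (×-distrib-+)
  open import Algebra.Properties.Ring ring
    using (-‿distribˡ-*; -‿distribʳ-*; -‿involutive; +-inverseˡ-unique; +-inverseʳ-unique; +-identityˡ-unique)
  open import Algebra.Properties.CommutativeSemigroup *-commutativeSemigroup using (x∙yz≈y∙xz)
  open import Relation.Binary.Reasoning.Setoid setoid
  open MagmaMorphisms +-rawMagma +-rawMagma public
    using () renaming (IsMagmaHomomorphism to IsAdditive)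

  TorsionFree : Set (c ⊔ ℓ)
  TorsionFree = ∀ n x → suc n × x ≈ 0# → x ≈ 0#

  module Additive {F : Carrier → Carrier} (F-additive : IsAdditive F) where
    open MagmaMorphisms.IsMagmaHomomorphism F-additive public
      using (homo) renaming (⟦⟧-cong to cong)

    0-homo : F 0# ≈ 0#
    0-homo = +-identityˡ-unique (F 0#) (F 0#) (trans (sym (homo 0# 0#)) (cong (+-identityˡ 0#)))

    neg-homo : ∀ x → F (- x) ≈ - F x
    neg-homo x = +-inverseʳ-unique (F x) (F (- x))
      (trans (sym (homo x (- x))) (trans (cong (-‿inverseʳ x)) 0-homo))

    ×-homo : ∀ n x → F (n × x) ≈ n × F x
    ×-homo zero    x = 0-homo
    ×-homo (suc n) x = trans (homo x (n × x)) (+-congˡ (×-homo n x))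

  infix 4 _∈ℤ[_]
  -- Only additive operations are constructors, so two additive maps can be compared by induction
  -- from their values at powers; closure under products is derived in `*∈`.
  data _∈ℤ[_] : Carrier → Carrier → Set (c ⊔ ℓ) where
    pow  : ∀ {z} k → z ^ k ∈ℤ[ z ]
    plus : ∀ {x y z} → x ∈ℤ[ z ] → y ∈ℤ[ z ] → x + y ∈ℤ[ z ]
    neg  : ∀ {x z} → x ∈ℤ[ z ] → - x ∈ℤ[ z ]
    resp : ∀ {x y z} → x ≈ y → x ∈ℤ[ z ] → y ∈ℤ[ z ]

  module _ {z : Carrier} where

    0∈ : 0# ∈ℤ[ z ]
    0∈ = resp (-‿inverseʳ _) (plus (pow 0) (neg (pow 0)))

    ×∈ : ∀ n {x} → x ∈ℤ[ z ] → n × x ∈ℤ[ z ]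
    ×∈ zero    X = 0∈
    ×∈ (suc n) X = plus X (×∈ n X)

    ·∈ : ∀ n {x} → x ∈ℤ[ z ] → n · x ∈ℤ[ z ]
    ·∈ (ℤ.+ n)    X = ×∈ n X
    ·∈ ℤ.-[1+ n ] X = neg (×∈ (suc n) X)

    *∈ : ∀ {x y} → x ∈ℤ[ z ] → y ∈ℤ[ z ] → x * y ∈ℤ[ z ]
    *∈ (pow j)     (pow k)     = resp (^-homo-* z j k) (pow (j ℕ.+ k))
    *∈ (pow j)     (plus X Y)  = resp (sym (distribˡ _ _ _)) (plus (*∈ (pow j) X) (*∈ (pow j) Y))
    *∈ (pow j)     (neg X)     = resp (-‿distribʳ-* _ _) (neg (*∈ (pow j) X))
    *∈ (pow j)     (resp eq X) = resp (*-congˡ eq) (*∈ (pow j) X)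
    *∈ (plus X X′) Y           = resp (sym (distribʳ _ _ _)) (plus (*∈ X Y) (*∈ X′ Y))
    *∈ (neg X)     Y           = resp (-‿distribˡ-* _ _) (neg (*∈ X Y))
    *∈ (resp eq X) Y           = resp (*-congʳ eq) (*∈ X Y)

    ^∈ : ∀ {x} k → x ∈ℤ[ z ] → x ^ k ∈ℤ[ z ]
    ^∈ zero    X = pow 0
    ^∈ (suc k) X = *∈ X (^∈ k X)

    ∑∈ : ∀ n {f : Fin n → Carrier} → (∀ i → f i ∈ℤ[ z ]) → ∑[ i < n ] f i ∈ℤ[ z ]
    ∑∈ zero    X = 0∈
    ∑∈ (suc n) X = plus (X fzero) (∑∈ n (X ∘ fsuc))

    additive-≈ : ∀ {F G} → IsAdditive F → IsAdditive G → (∀ k → F (z ^ k) ≈ G (z ^ k)) →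
                 ∀ {x} → x ∈ℤ[ z ] → F x ≈ G x
    additive-≈ {F} {G} F-add G-add eq = go
      where
      module F = Additive F-add
      module G = Additive G-add
      go : ∀ {x} → x ∈ℤ[ z ] → F x ≈ G x
      go (pow k)     = eq k
      go (plus X Y)  = trans (F.homo _ _) (trans (+-cong (go X) (go Y)) (sym (G.homo _ _)))
      go (neg X)     = trans (F.neg-homo _) (trans (-‿cong (go X)) (sym (G.neg-homo _)))
      go (resp e X)  = trans (F.cong (sym e)) (trans (go X) (G.cong e))

  -- Positive denominators over ℤ[z].

  Fraction : Carrier → Carrier → Set (c ⊔ ℓ)
  Fraction z x = ∃[ n ] suc n × x ∈ℤ[ z ]

  module _ (torsionFree : TorsionFree) where

    ×-cancel : ∀ n {x y} → suc n × x ≈ suc n × y → x ≈ y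
    ×-cancel n {x} {y} eq = begin
      x          ≈⟨ +-inverseˡ-unique x (- y) (torsionFree n _ (begin
        suc n × (x - y)              ≈⟨ ×-distrib-+ x (- y) (suc n) ⟩
        suc n × x + suc n × (- y)    ≈⟨ +-congʳ eq ⟩
        suc n × y + suc n × (- y)    ≈⟨ ×-distrib-+ y (- y) (suc n) ⟨
        suc n × (y - y)              ≈⟨ ×-congʳ (suc n) (-‿inverseʳ y) ⟩
        suc n × 0#                   ≈⟨ ×-zero (suc n) ⟩
        0#                           ∎)) ⟩
      - - y      ≈⟨ -‿involutive y ⟩
      y          ∎
      where
      ×-zero : ∀ n → n × 0# ≈ 0#
      ×-zero zero    = refl
      ×-zero (suc n) = trans (+-identityˡ _) (×-zero n)

    -- Clearing the denominator of `x` moves the comparison into ℤ[z]; torsion-freeness then cancels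
    -- it from the two values.
    additive-unique : ∀ {z} → (∀ x → Fraction z x) → ∀ {F G} → IsAdditive F → IsAdditive G →
                      (∀ k → F (z ^ k) ≈ G (z ^ k)) → ∀ x → F x ≈ G x
    additive-unique fraction {F} {G} F-add G-add eq x with fraction x
    ... | n , X = ×-cancel n (begin
      suc n × F x      ≈⟨ Additive.×-homo F-add (suc n) x ⟨
      F (suc n × x)    ≈⟨ additive-≈ F-add G-add eq X ⟩
      G (suc n × x)    ≈⟨ Additive.×-homo G-add (suc n) x ⟩
      suc n × G x      ∎)

    -- A factor w of the relation is cancelled by w * y ≈ m until its constant term is
    -- non-zero; multiplied by y, it then expresses a multiple of y as a polynomial in w.
    inverse-fraction : ∀ {z w y} m → w ∈ℤ[ z ] → w * y ≈ suc m × 1# →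
      ∀ d (a : Fin d → ℤ.ℤ) → w ^ d + ∑[ i < d ] (a i · w ^ toℕ i) ≈ 0# → Fraction z y
    -- In degree 0 the relation reads 1 = 0, so `y` vanishes and the denominator 1 serves.
    inverse-fraction {y = y} m W wy≈m zero a eq = 0 , resp (sym (begin
      y + 0#            ≈⟨ +-identityʳ y ⟩
      y                 ≈⟨ *-identityʳ y ⟨
      y * 1#            ≈⟨ *-congˡ (trans (sym (+-identityʳ 1#)) eq) ⟩
      y * 0#            ≈⟨ zeroʳ y ⟩
      0#                ∎)) 0∈
    inverse-fraction {z} {w} {y} m W wy≈m (suc d) a eq = go (a fzero) constantTerm
      where
      open AlgebraicIntegers R using (·1-*)
      open import Algebra.Properties.Semiring.Sum semiring using (*-distribˡ-sum; sum-cong-≋)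
      -- `B` is what remains of the relation once its constant term is removed and a factor `w` is
      -- taken out.
      T = ∑[ i < d ] (a (fsuc i) · w ^ toℕ i)
      B = w ^ d + T
      B∈ : B ∈ℤ[ z ]
      B∈ = plus (^∈ d W) (∑∈ d (λ i → ·∈ (a (fsuc i)) (^∈ (toℕ i) W)))
      shift : ∀ i → a (fsuc i) · (w * w ^ toℕ i) ≈ w * (a (fsuc i) · w ^ toℕ i)
      shift i = let n = a (fsuc i) ; u = w ^ toℕ i in begin
        n · (w * u)           ≈⟨ ·1-* n (w * u) ⟨
        (n · 1#) * (w * u)    ≈⟨ x∙yz≈y∙xz _ w u ⟩
        w * ((n · 1#) * u)    ≈⟨ *-congˡ (·1-* n u) ⟩
        w * (n · u)           ∎
      relation : a fzero · 1# + w * B ≈ 0#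
      relation = begin
        a fzero · 1# + w * B                   ≈⟨ +-congˡ (distribˡ w (w ^ d) T) ⟩
        a fzero · 1# + (w * w ^ d + w * T)     ≈⟨ x∙yz≈y∙xz′ _ _ _ ⟩
        w * w ^ d + (a fzero · 1# + w * T)
          ≈⟨ +-congˡ (+-congˡ (trans (*-distribˡ-sum w (λ i → a (fsuc i) · w ^ toℕ i))
                                     (sum-cong-≋ {n = d} (λ i → sym (shift i))))) ⟩
        _                                      ≈⟨ eq ⟩
        0#                                     ∎
        where
        open import Algebra.Properties.CommutativeSemigroup +-commutativeSemigroup
          using () renaming (x∙yz≈y∙xz to x∙yz≈y∙xz′)
      wBy : (w * B) * y ≈ suc m × B
      wBy = begin
        (w * B) * y           ≈⟨ *-assoc w B y ⟩
        w * (B * y)           ≈⟨ x∙yz≈y∙xz w B y ⟩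
        B * (w * y)           ≈⟨ *-congˡ wy≈m ⟩
        B * (suc m × 1#)      ≈⟨ ×-comm-* (suc m) B 1# ⟩
        suc m × (B * 1#)      ≈⟨ ×-congʳ (suc m) (*-identityʳ B) ⟩
        suc m × B             ∎
      constantTerm : a fzero · y ≈ - (suc m × B)
      constantTerm = +-inverseˡ-unique _ _ (begin
        a fzero · y + suc m × B                ≈⟨ +-cong (·1-* (a fzero) y) wBy ⟨
        (a fzero · 1#) * y + (w * B) * y       ≈⟨ distribʳ y _ _ ⟨
        (a fzero · 1# + w * B) * y             ≈⟨ *-congʳ relation ⟩
        0# * y                                 ≈⟨ zeroˡ y ⟩
        0#                                     ∎)
      mB∈ : - (suc m × B) ∈ℤ[ z ]
      mB∈ = neg (×∈ (suc m) B∈)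
      go : ∀ n → n · y ≈ - (suc m × B) → Fraction z y
      -- With constant term 0, torsion-freeness gives B = 0, a monic relation one degree lower.
      -- Otherwise the absolute value of the constant term is the denominator of `y`.
      go (ℤ.+ zero)    e = inverse-fraction m W wy≈m d (a ∘ fsuc) (torsionFree m B (begin
        suc m × B            ≈⟨ -‿involutive _ ⟨
        - - (suc m × B)      ≈⟨ -‿cong e ⟨
        - 0#                 ≈⟨ +-inverseʳ-unique 0# 0# (+-identityˡ 0#) ⟨
        0#                   ∎))
      go (ℤ.+ (suc n)) e = n , resp (sym e) mB∈
      go ℤ.-[1+ n ]    e = n , resp (trans (-‿cong (sym e)) (-‿involutive _)) (neg mB∈)

-- R stands for O_K: its equality is that of the first components, so working in O_K itself
-- would defeat unification.
module Criterion {c ℓ} (R : CommutativeRing c ℓ) where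
  open CommutativeRing R
  open Derivations R
  open PowerSpan R
  open import Algebra.Properties.Semiring.Exp semiring using (^-homo-*)
  open import Algebra.Properties.Ring ring
    using (x[y-z]≈xy-xz; [y-z]x≈yx-zx; x∙y⁻¹≈ε⇒x≈y; x≈y⇒x∙y⁻¹≈ε; +-cancelˡ; -‿+-comm)
  open import Algebra.Properties.CommutativeSemigroup +-commutativeSemigroup using (interchange)
  open import Algebra.Solver.Ring.NaturalCoefficients.Default commutativeSemiring using (solve; _:=_; _:+_; _:*_)
  open import Relation.Binary.Reasoning.Setoid setoid

  -- Stated as cancellation rather than as a disjunction, because equality in the field need not be
  -- decidable.
  NoZeroDivisors : Set (c ⊔ ℓ)
  NoZeroDivisors = ∀ {x y} → ¬ x ≈ 0# → x * y ≈ 0# → y ≈ 0#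

  -- Combinations of additive maps.

  additive : ∀ {F} → (∀ {x y} → x ≈ y → F x ≈ F y) → (∀ x y → F (x + y) ≈ F x + F y) → IsAdditive F
  additive F-cong F-homo = record { isRelHomomorphism = record { cong = F-cong } ; homo = F-homo }

  *ˡ-additive : ∀ x → IsAdditive (x *_)
  *ˡ-additive x = additive *-congˡ (distribˡ x)

  *ʳ-additive : ∀ x → IsAdditive (_* x)
  *ʳ-additive x = additive *-congʳ (λ y z → distribʳ x y z)

  ∘-additive : ∀ {F G} → IsAdditive F → IsAdditive G → IsAdditive (F ∘ G)
  ∘-additive F-add G-add = additive (F.cong ∘ G.cong) (λ x y → trans (F.cong (G.homo x y)) (F.homo _ _))
    where
    module F = Additive F-add
    module G = Additive G-add

  +-additive : ∀ {F G} → IsAdditive F → IsAdditive G → IsAdditive (λ x → F x + G x)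
  +-additive F-add G-add = additive (λ e → +-cong (F.cong e) (G.cong e))
    (λ x y → trans (+-cong (F.homo x y) (G.homo x y)) (interchange _ _ _ _))
    where
    module F = Additive F-add
    module G = Additive G-add

  neg-additive : IsAdditive (-_)
  neg-additive = additive -‿cong (λ x y → sym (-‿+-comm x y))

  -- Finite sums and linear recurrences.

  Σ< : ℕ → (ℕ → Carrier) → Carrier
  Σ< zero    f = 0#
  Σ< (suc n) f = Σ< n f + f n

  Σ<-cong : ∀ n {f g} → (∀ i → i < n → f i ≈ g i) → Σ< n f ≈ Σ< n g
  Σ<-cong zero    eq = refl
  Σ<-cong (suc n) eq = +-cong (Σ<-cong n (λ i i<n → eq i (ℕₚ.m<n⇒m<1+n i<n))) (eq n ℕₚ.≤-refl)

  Σ<-homo : ∀ {F} → IsAdditive F → ∀ n f → F (Σ< n f) ≈ Σ< n (F ∘ f)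
  Σ<-homo F-add zero    f = Additive.0-homo F-add
  Σ<-homo F-add (suc n) f = trans (Additive.homo F-add _ _) (+-congʳ (Σ<-homo F-add n f))

  geometric : ∀ z n → (z - 1#) * Σ< n (z ^_) ≈ z ^ n - 1#
  geometric z zero    = trans (zeroʳ _) (sym (-‿inverseʳ 1#))
  geometric z (suc n) = begin
    (z - 1#) * (Σ< n (z ^_) + z ^ n)                   ≈⟨ distribˡ _ _ _ ⟩
    (z - 1#) * Σ< n (z ^_) + (z - 1#) * z ^ n          ≈⟨ +-cong (geometric z n) ([y-z]x≈yx-zx _ _ _) ⟩
    (z ^ n - 1#) + (z * z ^ n - 1# * z ^ n)            ≈⟨ +-congˡ (+-congˡ (-‿cong (*-identityˡ _))) ⟩
    (z ^ n - 1#) + (z * z ^ n - z ^ n)                 ≈⟨ telescope (z ^ n) 1# (z * z ^ n) ⟩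
    z * z ^ n - 1#                                     ∎
    where
    telescope : ∀ a b c → (a - b) + (c - a) ≈ c - b
    telescope a b c = begin
      (a - b) + (c - a)        ≈⟨ solve 4 (λ a -b c -a → (a :+ -b) :+ (c :+ -a) := (a :+ -a) :+ (c :+ -b)) refl a (- b) c (- a) ⟩
      (a - a) + (c - b)        ≈⟨ +-congʳ (-‿inverseʳ a) ⟩
      0# + (c - b)             ≈⟨ +-identityˡ _ ⟩
      c - b                    ∎

  -- Vanishing of the sums over n + 2 consecutive terms is a recurrence of order n + 1.
  agree-by-recurrence : ∀ n {f g : ℕ → Carrier} →
    (∀ j → Σ< (suc (suc n)) (λ i → f (i ℕ.+ j)) ≈ 0#) →
    (∀ j → Σ< (suc (suc n)) (λ i → g (i ℕ.+ j)) ≈ 0#) →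
    (∀ k → k ≤ n → f k ≈ g k) → ∀ k → f k ≈ g k
  agree-by-recurrence n {f} {g} Σf≈0 Σg≈0 base k = window k 0 (s≤s z≤n)
    where
    -- `window j` is agreement on the `n + 1` indices from `j` on. Moving the window by one asks
    -- only for the new last index, supplied by `next`: there both sums vanish and all earlier terms
    -- already agree.
    window : ∀ j i → i < suc n → f (i ℕ.+ j) ≈ g (i ℕ.+ j)
    next : ∀ j → f (suc n ℕ.+ j) ≈ g (suc n ℕ.+ j)
    window zero    i (s≤s i≤n) =
      ≡.subst (λ l → f l ≈ g l) (≡.sym (ℕₚ.+-identityʳ i)) (base i i≤n)
    window (suc j) i i<1+n = ≡.subst (λ l → f l ≈ g l) (≡.sym (ℕₚ.+-suc i j)) (shifted (ℕₚ.m≤n⇒m<n∨m≡n i<1+n))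
      where
      shifted : _ → f (suc i ℕ.+ j) ≈ g (suc i ℕ.+ j)
      shifted (inj₁ 1+i<1+n) = window j (suc i) 1+i<1+n
      shifted (inj₂ ≡.refl)  = next j
    next j = +-cancelˡ _ _ _ (begin
      Σ< (suc n) (λ i → f (i ℕ.+ j)) + f (suc n ℕ.+ j)     ≈⟨ Σf≈0 j ⟩
      0#                                                   ≈⟨ Σg≈0 j ⟨
      Σ< (suc n) (λ i → g (i ℕ.+ j)) + g (suc n ℕ.+ j)     ≈⟨ +-congʳ (Σ<-cong (suc n) (window j)) ⟨
      Σ< (suc n) (λ i → f (i ℕ.+ j)) + g (suc n ℕ.+ j)     ∎)

  -- Meant for the tail of `S (suc k)`, whose pairs are those of `S k` with first entry raised by
  -- one. Arbitrary generators `g` and `g′` let the induction pass to shifted ones.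
  sumOver-scale : ∀ {a} {A : Set a} {s} (f : A → Carrier) {g g′ : ℕ → A} →
    (∀ i → f (g′ i) ≈ s * f (g i)) →
    ∀ n → sumOver (applyUpTo g′ n) f ≈ s * sumOver (applyUpTo g n) f
  sumOver-scale f eq zero    = sym (zeroʳ _)
  sumOver-scale f eq (suc n) =
    trans (+-cong (eq 0) (sumOver-scale f (eq ∘ suc) n)) (sym (distribˡ _ _ _))

  -- Non-zero endomorphisms of a domain.

  module Endomorphism (noZeroDivisors : NoZeroDivisors)
    {σ : Carrier → Carrier} (σ-end : IsEndomorphism σ) (σ≉0 : ¬ (∀ x → σ x ≈ 0#)) where
    open RingWithoutOneMorphisms.IsRingWithoutOneHomomorphism σ-end public
      using (*-homo; ⟦⟧-cong) renaming (+-isMagmaHomomorphism to isAdditive)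

    -- σ(1) is idempotent, so σ(1)(σ(1) - 1) = 0; and σ(1) = 0 would make σ zero.
    1-homo : σ 1# ≈ 1#
    1-homo = x∙y⁻¹≈ε⇒x≈y _ _ (noZeroDivisors σ1≉0 (begin
      σ 1# * (σ 1# - 1#)           ≈⟨ x[y-z]≈xy-xz _ _ _ ⟩
      σ 1# * σ 1# - σ 1# * 1#      ≈⟨ +-cong (sym (*-homo 1# 1#)) (-‿cong (*-identityʳ _)) ⟩
      σ (1# * 1#) - σ 1#           ≈⟨ +-congʳ (⟦⟧-cong (*-identityˡ 1#)) ⟩
      σ 1# - σ 1#                  ≈⟨ -‿inverseʳ _ ⟩
      0#                           ∎))
      where
      σ1≉0 : ¬ σ 1# ≈ 0#
      σ1≉0 e = σ≉0 λ x → begin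
        σ x            ≈⟨ ⟦⟧-cong (*-identityʳ x) ⟨
        σ (x * 1#)     ≈⟨ *-homo x 1# ⟩
        σ x * σ 1#     ≈⟨ *-congˡ e ⟩
        σ x * 0#       ≈⟨ zeroʳ _ ⟩
        0#             ∎

  -- The criterion for a torsion-free domain, with p = n + 2.

  module _
    (torsionFree : TorsionFree) (noZeroDivisors : NoZeroDivisors)
    (n : ℕ) (z : Carrier) (z^p≈1 : z ^ suc (suc n) ≈ 1#) (z≉1 : ¬ z ≈ 1#)
    (fraction : ∀ x → Fraction z x)
    {σ τ : Carrier → Carrier} (σ-end : IsEndomorphism σ) (τ-end : IsEndomorphism τ)
    (σ≉0 : ¬ (∀ x → σ x ≈ 0#)) (τ≉0 : ¬ (∀ x → τ x ≈ 0#)) (σ≉τ : ¬ (∀ x → σ x ≈ τ x))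
    {D : Carrier → Carrier} (D-linear : IsℤLinear D) (D1≈0 : D 1# ≈ 0#)
    where

    private
      module σ = Endomorphism noZeroDivisors σ-end σ≉0
      module τ = Endomorphism noZeroDivisors τ-end τ≉0
      s = σ z
      t = τ z

      D-additive : IsAdditive D
      D-additive = LeftModuleMorphisms.IsLeftModuleHomomorphism.+ᴹ-isMagmaHomomorphism D-linear

      module D = Additive D-additive

    -- The divided difference of s^k and t^k, defined without division. At 0 it is the empty sum,
    -- whereas `S (0 ∸ 1)` would contribute the term 1.
    h : ℕ → Carrier
    h zero    = 0#
    h (suc k) = τ (z ^ k) + s * h k

    -- The pair (0, k) contributes τ(z^k); every other pair carries a factor s, and taking it out
    -- leaves the previous sum.
    h-sumOver : ∀ k → sumOver (S k) (λ (i , j) → σ (z ^ i) * τ (z ^ j)) ≈ h (suc k)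
    h-sumOver zero = begin
      σ 1# * τ 1# + 0#       ≈⟨ +-cong (trans (*-congʳ σ.1-homo) (*-identityˡ _)) (sym (zeroʳ s)) ⟩
      τ 1# + s * 0#          ∎
    h-sumOver (suc k) = +-cong (trans (*-congʳ σ.1-homo) (*-identityˡ _))
      (trans (sumOver-scale (λ (i , j) → σ (z ^ i) * τ (z ^ j))
               {λ i → i , k ∸ i} {λ i → suc i , suc k ∸ suc i}
               (λ i → trans (*-congʳ (σ.*-homo z (z ^ i))) (*-assoc _ _ _)) (suc k))
             (*-congˡ (h-sumOver k)))

    -- The factorisation of s^k - t^k. It makes (s - t) h(k) the value at z^k of the additive map σ
    -- - τ.
    h-difference : ∀ k → (s - t) * h k ≈ σ (z ^ k) - τ (z ^ k)
    h-difference zero = begin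
      (s - t) * 0#      ≈⟨ zeroʳ _ ⟩
      0#                ≈⟨ x≈y⇒x∙y⁻¹≈ε (trans σ.1-homo (sym τ.1-homo)) ⟨
      σ 1# - τ 1#       ∎
    h-difference (suc k) = begin
      (s - t) * (τᵏ + s * h k)
        ≈⟨ solve 4 (λ u a s h → u :* (a :+ s :* h) := u :* a :+ s :* (u :* h)) refl (s - t) τᵏ s (h k) ⟩
      (s - t) * τᵏ + s * ((s - t) * h k)
        ≈⟨ +-cong ([y-z]x≈yx-zx _ _ _) (trans (*-congˡ (h-difference k)) (x[y-z]≈xy-xz _ _ _)) ⟩
      (s * τᵏ - t * τᵏ) + (s * σᵏ - s * τᵏ)
        ≈⟨ solve 4 (λ a b c d → (a :+ b) :+ (c :+ d) := (c :+ b) :+ (a :+ d)) refl (s * τᵏ) (- (t * τᵏ)) (s * σᵏ) (- (s * τᵏ)) ⟩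
      (s * σᵏ - t * τᵏ) + (s * τᵏ - s * τᵏ)
        ≈⟨ trans (+-congˡ (-‿inverseʳ _)) (+-identityʳ _) ⟩
      s * σᵏ - t * τᵏ
        ≈⟨ +-cong (σ.*-homo z (z ^ k)) (-‿cong (τ.*-homo z (z ^ k))) ⟨
      σ (z * z ^ k) - τ (z * z ^ k) ∎
      where
      σᵏ = σ (z ^ k)
      τᵏ = τ (z ^ k)

    -- Among the pairs with i + j = a + b - 1, those with i < a share the factor t^b and the others
    -- share s^a.
    h-+ : ∀ a b → h (a ℕ.+ b) ≈ h a * τ (z ^ b) + σ (z ^ a) * h b
    h-+ zero b = begin
      h b                                 ≈⟨ *-identityˡ _ ⟨
      1# * h b                            ≈⟨ *-congʳ σ.1-homo ⟨
      σ 1# * h b                          ≈⟨ +-identityˡ _ ⟨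
      0# + σ 1# * h b                     ≈⟨ +-congʳ (zeroˡ _) ⟨
      0# * τ (z ^ b) + σ 1# * h b         ∎
    h-+ (suc a) b = begin
      τ (z ^ (a ℕ.+ b)) + s * h (a ℕ.+ b)
        ≈⟨ +-cong (trans (τ.⟦⟧-cong (^-homo-* z a b)) (τ.*-homo _ _)) (*-congˡ (h-+ a b)) ⟩
      τ (z ^ a) * τ (z ^ b) + s * (h a * τ (z ^ b) + σ (z ^ a) * h b)
        ≈⟨ solve 6 (λ ta tb s ha sa hb → ta :* tb :+ s :* (ha :* tb :+ sa :* hb) := (ta :+ s :* ha) :* tb :+ (s :* sa) :* hb)
             refl (τ (z ^ a)) (τ (z ^ b)) s (h a) (σ (z ^ a)) (h b) ⟩
      (τ (z ^ a) + s * h a) * τ (z ^ b) + (s * σ (z ^ a)) * h b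
        ≈⟨ +-congˡ (*-congʳ (σ.*-homo z (z ^ a))) ⟨
      (τ (z ^ a) + s * h a) * τ (z ^ b) + σ (z * z ^ a) * h b ∎

    endomorphism-^-cong : s ≈ t → ∀ k → σ (z ^ k) ≈ τ (z ^ k)
    endomorphism-^-cong s≈t zero    = trans σ.1-homo (sym τ.1-homo)
    endomorphism-^-cong s≈t (suc k) = begin
      σ (z * z ^ k)      ≈⟨ σ.*-homo z (z ^ k) ⟩
      s * σ (z ^ k)      ≈⟨ *-cong s≈t (endomorphism-^-cong s≈t k) ⟩
      t * τ (z ^ k)      ≈⟨ τ.*-homo z (z ^ k) ⟨
      τ (z * z ^ k)      ∎

    -- If s = t, then σ and τ agree on the powers of z and hence everywhere.
    s≉t : ¬ s - t ≈ 0#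
    s≉t s-t≈0 = σ≉τ (additive-unique torsionFree fraction σ.isAdditive τ.isAdditive
      (endomorphism-^-cong (x∙y⁻¹≈ε⇒x≈y _ _ s-t≈0)))

    -- The sum is z^j times 1 + z + ... + z^(p-1), and z - 1 can be cancelled from the geometric
    -- identity.
    Σz≈0 : ∀ j → Σ< (suc (suc n)) (λ i → z ^ (i ℕ.+ j)) ≈ 0#
    Σz≈0 j = begin
      Σ< (suc (suc n)) (λ i → z ^ (i ℕ.+ j))       ≈⟨ Σ<-cong (suc (suc n)) (λ i _ → ^-homo-* z i j) ⟩
      Σ< (suc (suc n)) (λ i → z ^ i * z ^ j)       ≈⟨ Σ<-homo (*ʳ-additive (z ^ j)) (suc (suc n)) (z ^_) ⟨
      Σ< (suc (suc n)) (z ^_) * z ^ j              ≈⟨ *-congʳ (noZeroDivisors (z≉1 ∘ x∙y⁻¹≈ε⇒x≈y _ _)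
                                                        (trans (geometric z (suc (suc n))) (x≈y⇒x∙y⁻¹≈ε z^p≈1))) ⟩
      0# * z ^ j                                   ≈⟨ zeroˡ _ ⟩
      0#                                           ∎

    Σ-additive≈0 : ∀ {F} → IsAdditive F → ∀ j → Σ< (suc (suc n)) (λ i → F (z ^ (i ℕ.+ j))) ≈ 0#
    Σ-additive≈0 F-add j = trans (sym (Σ<-homo F-add (suc (suc n)) (λ i → z ^ (i ℕ.+ j))))
      (trans (Additive.cong F-add (Σz≈0 j)) (Additive.0-homo F-add))

    -- Multiplication by s - t turns `h` into an additive map evaluated at powers of z, whose window
    -- sums vanish; then s - t is cancelled.
    Σh≈0 : ∀ j → Σ< (suc (suc n)) (λ i → h (i ℕ.+ j)) ≈ 0#
    Σh≈0 j = noZeroDivisors s≉t (begin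
      (s - t) * Σ< (suc (suc n)) (λ i → h (i ℕ.+ j))
        ≈⟨ Σ<-homo (*ˡ-additive (s - t)) (suc (suc n)) (λ i → h (i ℕ.+ j)) ⟩
      Σ< (suc (suc n)) (λ i → (s - t) * h (i ℕ.+ j))
        ≈⟨ Σ<-cong (suc (suc n)) (λ i _ → h-difference (i ℕ.+ j)) ⟩
      Σ< (suc (suc n)) (λ i → σ (z ^ (i ℕ.+ j)) - τ (z ^ (i ℕ.+ j)))
        ≈⟨ Σ-additive≈0 (+-additive σ.isAdditive (∘-additive neg-additive τ.isAdditive)) j ⟩
      0# ∎)

    -- Splitting one factor z off on the left reproduces the recursion of `h`.
    leibniz⇒formula : (∀ x y → D (x * y) ≈ D x * τ y + σ x * D y) → ∀ k → D (z ^ k) ≈ h k * D z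
    leibniz⇒formula leibniz zero    = trans D1≈0 (sym (zeroˡ _))
    leibniz⇒formula leibniz (suc k) = begin
      D (z * z ^ k)                          ≈⟨ leibniz z (z ^ k) ⟩
      D z * τ (z ^ k) + s * D (z ^ k)        ≈⟨ +-congˡ (*-congˡ (leibniz⇒formula leibniz k)) ⟩
      D z * τ (z ^ k) + s * (h k * D z)
        ≈⟨ solve 4 (λ d a s h → d :* a :+ s :* (h :* d) := (a :+ s :* h) :* d) refl (D z) (τ (z ^ k)) s (h k) ⟩
      (τ (z ^ k) + s * h k) * D z            ∎

    formula⇒leibniz : (∀ k → D (z ^ k) ≈ h k * D z) → ∀ x y → D (x * y) ≈ D x * τ y + σ x * D y
    formula⇒leibniz formula x y =
      -- Both sides are additive in each argument: first `x` is reduced to z^a with `y` fixed, then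
      -- `y` to a power of z.
      additive-unique torsionFree fraction
        (∘-additive D-additive (*ʳ-additive y))
        (+-additive (∘-additive (*ʳ-additive (τ y)) D-additive) (∘-additive (*ʳ-additive (D y)) σ.isAdditive))
        (λ a → additive-unique torsionFree fraction
          (∘-additive D-additive (*ˡ-additive (z ^ a)))
          (+-additive (∘-additive (*ˡ-additive (D (z ^ a))) τ.isAdditive) (∘-additive (*ˡ-additive (σ (z ^ a))) D-additive))
          (on-powers a) y)
        x
      where
      on-powers : ∀ a b → D (z ^ a * z ^ b) ≈ D (z ^ a) * τ (z ^ b) + σ (z ^ a) * D (z ^ b)
      on-powers a b = begin
        D (z ^ a * z ^ b)                                   ≈⟨ D.cong (^-homo-* z a b) ⟨
        D (z ^ (a ℕ.+ b))                                   ≈⟨ formula (a ℕ.+ b) ⟩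
        h (a ℕ.+ b) * D z                                   ≈⟨ *-congʳ (h-+ a b) ⟩
        (h a * τ (z ^ b) + σ (z ^ a) * h b) * D z
          ≈⟨ solve 5 (λ ha tb sa hb d → (ha :* tb :+ sa :* hb) :* d := (ha :* d) :* tb :+ sa :* (hb :* d))
               refl (h a) (τ (z ^ b)) (σ (z ^ a)) (h b) (D z) ⟩
        (h a * D z) * τ (z ^ b) + σ (z ^ a) * (h b * D z)   ≈⟨ +-cong (*-congʳ (formula a)) (*-congˡ (formula b)) ⟨
        D (z ^ a) * τ (z ^ b) + σ (z ^ a) * D (z ^ b)       ∎

    criterion : IsDerivation σ τ D
      ⇔
      (∀ k → 1 ≤ k → k ≤ n →
         D (z ^ k) ≈ sumOver (S (k ∸ 1)) (λ (i , j) → σ (z ^ i) * τ (z ^ j)) * D z)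
    criterion = mk⇔ to from
      where
      to : IsDerivation σ τ D → _
      to D-der (suc k) _ _ = trans (leibniz⇒formula (IsDerivation.leibniz D-der) (suc k))
        (*-congʳ (sym (h-sumOver k)))
      from : _ → IsDerivation σ τ D
      from formula = record
        { isℤLinear = D-linear
        ; leibniz   = formula⇒leibniz (agree-by-recurrence n (Σ-additive≈0 D-additive) Σhd≈0 base)
        }
        where
        Σhd≈0 : ∀ j → Σ< (suc (suc n)) (λ i → h (i ℕ.+ j) * D z) ≈ 0#
        Σhd≈0 j = trans (sym (Σ<-homo (*ʳ-additive (D z)) (suc (suc n)) (λ i → h (i ℕ.+ j))))
          (trans (*-congʳ (Σh≈0 j)) (zeroˡ _))
        -- The recurrence needs the p - 1 starting values at 0, ..., p - 2: the value at 0 is D(1) =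
        -- 0, the others are the hypothesis.
        base : ∀ k → k ≤ n → D (z ^ k) ≈ h k * D z
        base zero    _   = trans D1≈0 (sym (zeroˡ _))
        base (suc k) k<n = trans (formula (suc k) (s≤s z≤n) k<n) (*-congʳ (h-sumOver k))

-- The field ℚ(ζ) and its ring of integers.

module CyclotomicField {c ℓ₁ ℓ₂} (K : HeytingField c ℓ₁ ℓ₂)
  (char0 : FieldNotions.CharacteristicZero K) where
  open FieldNotions K hiding (CharacteristicZero)
  open HeytingField K using (_#_; #⇒invertible; tight)
  open CommutativeRing commutativeRing
  open PowerSpan commutativeRing
  open Criterion commutativeRing using (NoZeroDivisors; neg-additive)
  private
    module 𝓞 = CommutativeRing 𝓞K
    module 𝓞-Span = PowerSpan 𝓞K
  open AlgebraicIntegers commutativeRing using (_^_)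
  open import Algebra.Properties.Semiring.Mult semiring
    using (_×_; ×-congʳ; ×-assocˡ; ×-assoc-*; ×-comm-*)
  open import Algebra.Properties.Semiring.Mult 𝓞.semiring using () renaming (_×_ to _𝓞×_)
  open import Algebra.Properties.Semiring.Exp 𝓞.semiring using () renaming (_^_ to _𝓞^_)
  open import Algebra.Properties.CommutativeMonoid.Mult +-commutativeMonoid using (×-distrib-+)
  open import Algebra.Properties.Ring ring using (-0#≈0#)
  open import Relation.Binary.Reasoning.Setoid setoid

  cancel-apart : ∀ {x y} → x # 0# → x * y ≈ 0# → y ≈ 0#
  cancel-apart {x} {y} x#0 xy≈0 with #⇒invertible x#0
  ... | x⁻¹ , x⁻¹x≈1 , _ = begin
    y                          ≈⟨ *-identityˡ y ⟨
    1# * y                     ≈⟨ *-congʳ x⁻¹x≈1 ⟨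
    -- Apartness from 0 yields an inverse of the difference x - 0, which is then simplified to x.
    (x⁻¹ * (x - 0#)) * y       ≈⟨ *-assoc _ _ _ ⟩
    x⁻¹ * ((x - 0#) * y)       ≈⟨ *-congˡ (*-congʳ (trans (+-congˡ -0#≈0#) (+-identityʳ x))) ⟩
    x⁻¹ * (x * y)              ≈⟨ *-congˡ xy≈0 ⟩
    x⁻¹ * 0#                   ≈⟨ zeroʳ _ ⟩
    0#                         ∎

  -- x ≠ 0 is weaker than apartness and gives no inverse. By tightness it suffices to refute y # 0,
  -- and then `y` can be cancelled instead, forcing x = 0.
  noZeroDivisors : NoZeroDivisors
  noZeroDivisors {x} {y} x≉0 xy≈0 = proj₁ (tight y 0#) λ y#0 →
    x≉0 (cancel-apart y#0 (trans (*-comm y x) xy≈0))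

  torsionFree : TorsionFree
  torsionFree n x nx≈0 = cancel-apart (char0 (suc n)) (begin
    (suc n × 1#) * x       ≈⟨ ×-assoc-* (suc n) 1# x ⟩
    suc n × (1# * x)       ≈⟨ ×-congʳ (suc n) (*-identityˡ x) ⟩
    suc n × x              ≈⟨ nx≈0 ⟩
    0#                     ∎)

  proj₁-× : ∀ n x → proj₁ (n 𝓞× x) ≡ n × proj₁ x
  proj₁-× zero    x = ≡.refl
  proj₁-× (suc n) x = ≡.cong (proj₁ x +_) (proj₁-× n x)

  proj₁-^ : ∀ x n → proj₁ (x 𝓞^ n) ≡ proj₁ x ^ n
  proj₁-^ x zero    = ≡.refl
  proj₁-^ x (suc n) = ≡.cong (proj₁ x *_) (proj₁-^ x n)

  module _ {z : 𝓞.Carrier} where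

    -- The lift serves twice: it equips an element of ℤ[z] with a monic equation, and it carries
    -- membership from K over to O_K.
    lift-span : ∀ {x} → x ∈ℤ[ proj₁ z ] → Σ[ X ∈ 𝓞.Carrier ] proj₁ X ≈ x ∧ X 𝓞-Span.∈ℤ[ z ]
    lift-span (pow k) = z 𝓞^ k , reflexive (proj₁-^ z k) , 𝓞-Span.pow k
    lift-span (plus p q) with lift-span p | lift-span q
    ... | X , eX , pX | Y , eY , pY = X 𝓞.+ Y , +-cong eX eY , 𝓞-Span.plus pX pY
    lift-span (neg p) with lift-span p
    ... | X , eX , pX = 𝓞.- X , -‿cong eX , 𝓞-Span.neg pX
    lift-span (resp e p) with lift-span p
    ... | X , eX , pX = X , trans eX e , pX

    -- Sums and products use the product of the denominators; only inverses call on integrality.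
    ℚ-fraction : ∀ {x} → ℚ⟨ proj₁ z ⟩ x → Fraction (proj₁ z) x
    ℚ-fraction gen = 0 , resp (trans (*-identityʳ _) (sym (+-identityʳ _))) (pow 1)
    ℚ-fraction one = 0 , resp (sym (+-identityʳ _)) (pow 0)
    ℚ-fraction (plus {x} {y} p q) with ℚ-fraction p | ℚ-fraction q
    -- The witness is the predecessor of (m + 1)(n + 1).
    ... | m , X | n , Y = n ℕ.+ m ℕ.* suc n , resp (begin
      suc n × (suc m × x) + suc m × (suc n × y)
        ≈⟨ +-cong (×-assocˡ x (suc n) (suc m)) (×-assocˡ y (suc m) (suc n)) ⟩
      (suc n ℕ.* suc m) × x + (suc m ℕ.* suc n) × y
        ≡⟨ ≡.cong (λ k → k × x + (suc m ℕ.* suc n) × y) (ℕₚ.*-comm (suc n) (suc m)) ⟩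
      (suc m ℕ.* suc n) × x + (suc m ℕ.* suc n) × y
        ≈⟨ ×-distrib-+ x y (suc m ℕ.* suc n) ⟨
      (suc m ℕ.* suc n) × (x + y) ∎)
      (plus (×∈ (suc n) X) (×∈ (suc m) Y))
    ℚ-fraction (neg {x} p) with ℚ-fraction p
    ... | m , X = m , resp (Additive.×-homo neg-additive (suc m) x) (neg X)
    ℚ-fraction (times {x} {y} p q) with ℚ-fraction p | ℚ-fraction q
    ... | m , X | n , Y = n ℕ.+ m ℕ.* suc n , resp (begin
      (suc m × x) * (suc n × y)        ≈⟨ ×-assoc-* (suc m) x _ ⟩
      suc m × (x * (suc n × y))        ≈⟨ ×-congʳ (suc m) (×-comm-* (suc n) x y) ⟩
      suc m × (suc n × (x * y))        ≈⟨ ×-assocˡ (x * y) (suc m) (suc n) ⟩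
      (suc m ℕ.* suc n) × (x * y)      ∎)
      (*∈ X Y)
    ℚ-fraction (inv {x} {y} p xy≈1) with ℚ-fraction p
    ... | m , X with lift-span X
    -- The cleared multiple `w` of `x` is an algebraic integer with w y = m + 1, so its monic
    -- equation yields a denominator for `y`.
    ... | (w , d , a , root-eq) , w≈mx , _ =
      inverse-fraction torsionFree m (resp (sym w≈mx) X) (begin
        w * y                  ≈⟨ *-congʳ w≈mx ⟩
        (suc m × x) * y        ≈⟨ ×-assoc-* (suc m) x y ⟩
        suc m × (x * y)        ≈⟨ ×-congʳ (suc m) xy≈1 ⟩
        suc m × 1#             ∎) d a root-eq
    ℚ-fraction (resp e p) with ℚ-fraction p
    ... | m , X = m , resp (×-congʳ (suc m) e) X

    𝓞-fraction : (∀ x → ℚ⟨ proj₁ z ⟩ x) → ∀ x → 𝓞-Span.Fraction z x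
    𝓞-fraction ℚζ (x , x-int) with ℚ-fraction (ℚζ x)
    ... | n , nx∈ with lift-span nx∈
    ... | X , X≈nx , X∈ = n , 𝓞-Span.resp (trans X≈nx (reflexive (≡.sym (proj₁-× (suc n) (x , x-int))))) X∈

  𝓞-torsionFree : 𝓞-Span.TorsionFree
  𝓞-torsionFree n x nx≈0 = torsionFree n (proj₁ x)
    (trans (reflexive (≡.sym (proj₁-× (suc n) x))) nx≈0)

theorem3p8 : ∀ {c ℓ₁ ℓ₂} (p : ℕ) → Prime p → 2 ∤ p →
    (K : HeytingField c ℓ₁ ℓ₂) →
    let open FieldNotions K in
    CharacteristicZero →
    ∀ ζ (ζ-prim : IsPrimitiveRoot p ζ) → (∀ x → ℚ⟨ ζ ⟩ x) →
    let open CommutativeRing 𝓞K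
        open Derivations 𝓞K
        z = root ζ-prim
    in
    (σ τ : Carrier → Carrier) → IsEndomorphism σ → IsEndomorphism τ →
    ¬ (∀ x → σ x ≈ 0#) → ¬ (∀ x → τ x ≈ 0#) → ¬ (∀ x → σ x ≈ τ x) →
    (D : Carrier → Carrier) → IsℤLinear D → D 1# ≈ 0# →
    IsDerivation σ τ D
      ⇔
    (∀ k → 1 ≤ k → k ≤ p ∸ 2 →
       D (z ^ k) ≈ sumOver (S (k ∸ 1)) (λ (i , j) → σ (z ^ i) * τ (z ^ j)) * D z)
-- Excluding 0 and 1 puts p in the form n + 2, so that p ∸ 2 computes to n.
theorem3p8 zero          p-prime = ⊥-elim (¬prime[0] p-prime)
theorem3p8 (suc zero)    p-prime = ⊥-elim (¬prime[1] p-prime)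
theorem3p8 (suc (suc n)) _ _ K char0 ζ ζ-prim ℚζ σ τ σ-end τ-end σ≉0 τ≉0 σ≉τ D D-linear D1≈0 =
  -- Equality in O_K is equality in K, so cancellation in O_K is that of K.
  Criterion.criterion 𝓞K 𝓞-torsionFree (λ {x} {y} → noZeroDivisors {proj₁ x} {proj₁ y})
    n z z^p≈1 z≉1 (𝓞-fraction {z} ℚζ)
    σ-end τ-end σ≉0 τ≉0 σ≉τ D-linear D1≈0
  where
  open FieldNotions K
  open IsPrimitiveRoot ζ-prim
  open CyclotomicField K char0
  open CommutativeRing commutativeRing
  open AlgebraicIntegers commutativeRing using (_^_)
  z = root ζ-prim
  z^p≈1 = trans (reflexive (proj₁-^ z (suc (suc n)))) ζ^n≈1
  z≉1 : ¬ ζ ≈ 1#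
  z≉1 ζ≈1 = ζ^k≉1 1 (s≤s z≤n) (s≤s (s≤s z≤n)) (trans (*-identityʳ ζ) ζ≈1)
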